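{- Let $s$ be a term that reduces to an abstraction $t$ by a reduction sequence $s=s_0\succ\cdots\succ s_j=t$ whose largest term has size $m=\max_i|s_i|$. Then there are a program $P$ and a number $m'$ with $P\gg t$ and $m\le m'\le 2m$ such that the substitution machine reduces $\tau_s$ to $([],[P])$ by a sequence of steps whose largest state has size $m'$.
   Context: Terms (de Bruijn): $s::=n\mid st\mid\lambda s$, size $|n|=1+n$, $|\lambda s|=1+|s|$, $|st|=1+|s|+|t|$. Term substitution: $k^k_u=u$, $n^k_u=n$ ($n\ne k$), $(st)^k_u=(s^k_u)(t^k_u)$, $(\lambda s)^k_u=\lambda(s^{k+1}_u)$. Reduction $\succ$: $(\lambda s)(\lambda t)\succ s^0_{\lambda t}$; $s\succ s'\Rightarrow st\succ s't$; $t\succ t'\Rightarrow(\lambda s)t\succ(\lambda s)t'$. Programs are lists of commands $\mathsf{ret},\mathsf{var}\,n,\mathsf{lam},\mathsf{app}$ with sizes $|\mathsf{var}\,n|=1+n$, $|c|=1$ otherwise, $|P|=1+\sum_{c\in P}|c|$. Compilation: $\gamma n=[\mathsf{var}\,n]$, $\gamma(st)=\gamma s++\gamma t++[\mathsf{app}]$, $\gamma(\lambda s)=\mathsf{lam}::\gamma s++[\mathsf{ret}]$. $P\gg s$ iff $P=\gamma u$ and $s=\lambda u$ for some $u$. $\varphi P:=\varphi_{0,[]}P$ with $\varphi_{0,Q}(\mathsf{ret}::P)=(Q,P)$, $\varphi_{k+1,Q}(\mathsf{ret}::P)=\varphi_{k,Q++[\mathsf{ret}]}P$, $\varphi_{k,Q}(\mathsf{lam}::P)=\varphi_{k+1,Q++[\mathsf{lam}]}P$,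 $\varphi_{k,Q}(c::P)=\varphi_{k,Q++[c]}P$ for $c$ a $\mathsf{var}$ or $\mathsf{app}$, undefined otherwise. Program substitution: $(\mathsf{var}\,k::P)^k_Q=Q++P^k_Q$; $(\mathsf{var}\,n::P)^k_Q=\mathsf{var}\,n::P^k_Q$ ($n\ne k$); $(\mathsf{lam}::P)^k_Q=\mathsf{lam}::P^{k+1}_Q$; $(\mathsf{app}::P)^k_Q=\mathsf{app}::P^k_Q$; $(\mathsf{ret}::P)^0_Q=[\mathsf{ret}]$; $(\mathsf{ret}::P)^{k+1}_Q=\mathsf{ret}::P^k_Q$; $[]^k_Q=[]$. The substitution machine has states $(T,V)$ ($T,V$ lists of programs) and steps: $((\mathsf{lam}::P)::T,V)\succ(P'::_{tc}T,\ Q::V)$ if $\varphi P=(Q,P')$; $((\mathsf{app}::P)::T,\ Q::R::V)\succ(R^0_{\mathsf{lam}::Q++[\mathsf{ret}]}::(P::_{tc}T),\ V)$; where $P::_{tc}T:=T$ if $P=[]$, else $P::T$. Initial state $\tau_s:=([\gamma s],[])$. The size of a state $(T,V)$ is the sum of the sizes of all programs in $T$ and in $V$. -}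

module Defs where

open import Data.Bool using (if_then_else_)
open import Data.List using (List; []; _∷_; _++_; [_]; map)
open import Data.Maybe using (Maybe; just; nothing)
open import Data.Nat using (ℕ; zero; suc; _+_; _⊔_; _≟_)
open import Data.Nat.ListAction using (sum)
open import Data.Product using (∃; _×_; _,_)
open import Level using (Level)
open import Relation.Binary.Construct.Closure.ReflexiveTransitive using (Star; ε; _◅_)
open import Relation.Binary.Core using (Rel)
open import Relation.Binary.PropositionalEquality using (_≡_)
open import Relation.Nullary using (does)

infixl 7 _·_
infixr 6 ƛ_
infix 4 _≻_ _≫_ _⟶_
infixr 5 _∷tc_

data Term : Set where
  var : ℕ → Term
  _·_ : Term → Term → Term
  ƛ_  : Term → Term

size : Term → ℕ
size (var n) = 1 + n
size (s · t) = 1 + size s + size t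
size (ƛ s)   = 1 + size s

-- subst s k u is sᵏᵤ.  Nothing is shifted in u when passing under ƛ, so
-- capture is possible if u is open.
subst : Term → ℕ → Term → Term
subst (var n) k u = if does (n ≟ k) then u else var n
subst (s · t) k u = subst s k u · subst t k u
subst (ƛ s)   k u = ƛ subst s (suc k) u

data _≻_ : Rel Term Level.zero where
  β    : ∀ {s t} → (ƛ s) · (ƛ t) ≻ subst s 0 (ƛ t)
  appˡ : ∀ {s s′ t} → s ≻ s′ → s · t ≻ s′ · t
  appʳ : ∀ {s t t′} → t ≻ t′ → (ƛ s) · t ≻ (ƛ s) · t′

Abstraction : Term → Set
Abstraction t = ∃ λ u → t ≡ ƛ u

data Com : Set where
  ret : Com
  var : ℕ → Com
  lam : Com
  app : Com

Prog : Set
Prog = List Com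

sizeC : Com → ℕ
sizeC ret     = 1
sizeC (var n) = 1 + n
sizeC lam     = 1
sizeC app     = 1

sizeP : Prog → ℕ
sizeP P = 1 + sum (map sizeC P)

γ : Term → Prog
γ (var n) = [ var n ]
γ (s · t) = γ s ++ γ t ++ [ app ]
γ (ƛ s)   = lam ∷ γ s ++ [ ret ]

_≫_ : Prog → Term → Set
P ≫ s = ∃ λ u → P ≡ γ u × s ≡ ƛ u

-- φ′ k Q P is φ_{k,Q} P.
φ′ : ℕ → Prog → Prog → Maybe (Prog × Prog)
φ′ k       Q []          = nothing
φ′ zero    Q (ret ∷ P)   = just (Q , P)
φ′ (suc k) Q (ret ∷ P)   = φ′ k (Q ++ [ ret ]) P
φ′ k       Q (lam ∷ P)   = φ′ (suc k) (Q ++ [ lam ]) P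
φ′ k       Q (var n ∷ P) = φ′ k (Q ++ [ var n ]) P
φ′ k       Q (app ∷ P)   = φ′ k (Q ++ [ app ]) P

φ : Prog → Maybe (Prog × Prog)
φ = φ′ 0 []

-- substP P k Q is Pᵏ_Q.
substP : Prog → ℕ → Prog → Prog
substP []          k       Q = []
substP (var n ∷ P) k       Q = if does (n ≟ k) then Q ++ substP P k Q
                                               else var n ∷ substP P k Q
substP (lam ∷ P)   k       Q = lam ∷ substP P (suc k) Q
substP (app ∷ P)   k       Q = app ∷ substP P k Q
substP (ret ∷ P)   zero    Q = [ ret ]
substP (ret ∷ P)   (suc k) Q = ret ∷ substP P k Q

_∷tc_ : Prog → List Prog → List Prog
[]      ∷tc T = T
(c ∷ P) ∷tc T = (c ∷ P) ∷ T

State : Set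
State = List Prog × List Prog

sizeS : State → ℕ
sizeS (T , V) = sum (map sizeP T) + sum (map sizeP V)

data _⟶_ : Rel State Level.zero where
  pushVal : ∀ {P P′ Q T V} → φ P ≡ just (Q , P′) →
            ((lam ∷ P) ∷ T , V) ⟶ (P′ ∷tc T , Q ∷ V)
  reduce  : ∀ {P Q R T V} →
            ((app ∷ P) ∷ T , Q ∷ R ∷ V) ⟶
            (substP R 0 (lam ∷ Q ++ [ ret ]) ∷ (P ∷tc T) , V)

τ : Term → State
τ s = ([ γ s ] , [])

-- The maximum of f over all elements x₀, …, xⱼ of a reduction sequence,
-- both endpoints included.
peak : ∀ {a ℓ} {A : Set a} {R : Rel A ℓ} {x y : A} → (A → ℕ) → Star R x y → ℕ
peak {x = x} f ε        = f x
peak {x = x} f (_ ◅ rs) = f x ⊔ peak f rs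

{-# OPTIONS --safe #-}
module Submission where

-- Every machine state in a run from τ s represents a term occurring in the
-- reduction of s.  A step s ≻ s′ is simulated by pushVal steps, which leave the
-- represented term unchanged, followed by one reduce step.  A state
-- representing s has size between |s| and 2|s|: γ adds one ret per
-- abstraction, and every task below the top of the stack contains an app, which
-- pays for the unit of size of that task.

open import Defs
open import Data.Bool using (true; false)
open import Data.List using (List; []; _∷_; _++_; [_]; map)
open import Data.List.Properties using (++-assoc; ++-identityʳ; map-++)
open import Data.Maybe using (just)
open import Data.Nat using (ℕ; zero; suc; _+_; _*_; _≤_; s≤s; _≟_)
open import Data.Nat.ListAction using (sum)
open import Data.Nat.ListAction.Properties using (sum-++)
open import Data.Nat.Properties
open import Data.Nat.Tactic.RingSolver using (solve-∀)
open import Data.Product using (Σ-syntax; _×_; _,_)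
open import Relation.Binary.Construct.Closure.Reflexive using (ReflClosure; refl; reflexive)
  renaming ([_] to one-step)
open import Relation.Binary.Construct.Closure.ReflexiveTransitive
  using (Star; ε; _◅_; _◅◅_; gmap)
open import Relation.Binary.PropositionalEquality
  using (_≡_; refl; sym; trans; cong; module ≡-Reasoning)
  renaming (subst to transport)
open import Relation.Nullary using (does)

-- Partially evaluated terms and the states they denote.

-- How far the machine has got with a term: "todo" is code not yet executed,
-- "val" an abstraction already on the value stack, and "called" a subterm
-- evaluated in a task of its own.
data Partial : Term → Set where
  todo   : ∀ s → Partial s
  val    : ∀ u → Partial (ƛ u)
  appL   : ∀ {s} → Partial s → ∀ t → Partial (s · t)
  appR   : ∀ u {t} → Partial t → Partial ((ƛ u) · t)
  called : ∀ {s} → Partial s → Partial s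

-- P is the code to be run after s within the same task.
state : ∀ {s} → Partial s → Prog → List Prog → List Prog → State
state (todo s)   P T V = (γ s ++ P) ∷tc T , V
state (val u)    P T V = P ∷tc T , γ u ∷ V
state (appL c t) P T V = state c (γ t ++ app ∷ P) T V
state (appR u c) P T V = state c (app ∷ P) T (γ u ∷ V)
-- The called code has an empty continuation of its own; an empty `P` leaves no task behind, as in a
-- tail call.
state (called c) P T V = state c [] (P ∷tc T) V

-- `γ s` always begins with a command, so `∷tc` never drops the task.
∷tc-γ : ∀ s P T → (γ s ++ P) ∷tc T ≡ (γ s ++ P) ∷ T
∷tc-γ (var n) P T = refl
∷tc-γ (s · t) P T
  rewrite ++-assoc (γ s) (γ t ++ [ app ]) P = ∷tc-γ s _ T
∷tc-γ (ƛ s)   P T = refl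

-- Compiled code under extraction and substitution.

γ-·-++ : ∀ s t P → γ (s · t) ++ P ≡ γ s ++ γ t ++ app ∷ P
γ-·-++ s t P = trans (++-assoc (γ s) (γ t ++ [ app ]) P)
                     (cong (γ s ++_) (++-assoc (γ t) [ app ] P))

γ-ƛ-++ : ∀ s P → γ (ƛ s) ++ P ≡ lam ∷ γ s ++ ret ∷ P
γ-ƛ-++ s P = cong (lam ∷_) (++-assoc (γ s) [ ret ] P)

-- The clauses of `φ′` branch on the level, so this equation and the next two compute only once `k`
-- is a constructor.
φ′-var : ∀ k n Q P → φ′ k Q (var n ∷ P) ≡ φ′ k (Q ++ [ var n ]) P
φ′-var zero    n Q P = refl
φ′-var (suc k) n Q P = refl

φ′-lam : ∀ k Q P → φ′ k Q (lam ∷ P) ≡ φ′ (suc k) (Q ++ [ lam ]) P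
φ′-lam zero    Q P = refl
φ′-lam (suc k) Q P = refl

φ′-app : ∀ k Q P → φ′ k Q (app ∷ P) ≡ φ′ k (Q ++ [ app ]) P
φ′-app zero    Q P = refl
φ′-app (suc k) Q P = refl

-- Each `lam` in `γ s` is closed by its own `ret`: the level rises and falls back to `k`, and no
-- `ret` of `γ s` ends the scan.
φ′-γ : ∀ s k Q P → φ′ k Q (γ s ++ P) ≡ φ′ k (Q ++ γ s) P
φ′-γ (var n) k Q P = φ′-var k n Q P
φ′-γ (s · t) k Q P = begin
  φ′ k Q (γ (s · t) ++ P)                   ≡⟨ cong (φ′ k Q) (γ-·-++ s t P) ⟩
  φ′ k Q (γ s ++ γ t ++ app ∷ P)            ≡⟨ φ′-γ s k Q _ ⟩
  φ′ k (Q ++ γ s) (γ t ++ app ∷ P)          ≡⟨ φ′-γ t k _ _ ⟩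
  φ′ k ((Q ++ γ s) ++ γ t) (app ∷ P)        ≡⟨ φ′-app k _ P ⟩
  φ′ k (((Q ++ γ s) ++ γ t) ++ [ app ]) P   ≡⟨ cong (λ R → φ′ k R P) assoc ⟩
  φ′ k (Q ++ γ (s · t)) P                   ∎
  where
  open ≡-Reasoning
  assoc : ((Q ++ γ s) ++ γ t) ++ [ app ] ≡ Q ++ γ (s · t)
  assoc = trans (++-assoc (Q ++ γ s) (γ t) [ app ]) (++-assoc Q (γ s) _)
φ′-γ (ƛ s)   k Q P = begin
  φ′ k Q (γ (ƛ s) ++ P)                          ≡⟨ cong (φ′ k Q) (γ-ƛ-++ s P) ⟩
  φ′ k Q (lam ∷ γ s ++ ret ∷ P)                  ≡⟨ φ′-lam k Q _ ⟩
  φ′ (suc k) (Q ++ [ lam ]) (γ s ++ ret ∷ P)     ≡⟨ φ′-γ s (suc k) _ _ ⟩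
  φ′ k (((Q ++ [ lam ]) ++ γ s) ++ [ ret ]) P    ≡⟨ cong (λ R → φ′ k R P) assoc ⟩
  φ′ k (Q ++ γ (ƛ s)) P                          ∎
  where
  open ≡-Reasoning
  assoc : ((Q ++ [ lam ]) ++ γ s) ++ [ ret ] ≡ Q ++ γ (ƛ s)
  assoc = trans (++-assoc (Q ++ [ lam ]) (γ s) [ ret ]) (++-assoc Q [ lam ] _)

-- As `γ s` is balanced, the `ret` after it is the first one met at level 0.
φ-body : ∀ s P → φ ((γ s ++ [ ret ]) ++ P) ≡ just (γ s , P)
φ-body s P = trans (cong φ (++-assoc (γ s) [ ret ] P)) (φ′-γ s 0 [] (ret ∷ P))

-- By the same balance, `substP` does not stop inside `γ s` and reaches `P` at level `k`. Neither
-- substitution shifts what it inserts, so `γ u` serves at every depth.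
substP-γ : ∀ s k u P → substP (γ s ++ P) k (γ u) ≡ γ (subst s k u) ++ substP P k (γ u)
substP-γ (var n) k u P with does (n ≟ k)
... | true  = refl
... | false = refl
substP-γ (s · t) k u P = begin
  substP (γ (s · t) ++ P) k (γ u)
    ≡⟨ cong (λ R → substP R k (γ u)) (γ-·-++ s t P) ⟩
  substP (γ s ++ γ t ++ app ∷ P) k (γ u)
    ≡⟨ substP-γ s k u _ ⟩
  γ (subst s k u) ++ substP (γ t ++ app ∷ P) k (γ u)
    ≡⟨ cong (γ (subst s k u) ++_) (substP-γ t k u _) ⟩
  γ (subst s k u) ++ γ (subst t k u) ++ app ∷ substP P k (γ u)
    ≡⟨ γ-·-++ (subst s k u) (subst t k u) _ ⟨
  γ (subst (s · t) k u) ++ substP P k (γ u) ∎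
  where open ≡-Reasoning
substP-γ (ƛ s)   k u P = begin
  substP (γ (ƛ s) ++ P) k (γ u)
    ≡⟨ cong (λ R → substP R k (γ u)) (γ-ƛ-++ s P) ⟩
  lam ∷ substP (γ s ++ ret ∷ P) (suc k) (γ u)
    ≡⟨ cong (lam ∷_) (substP-γ s (suc k) u _) ⟩
  lam ∷ γ (subst s (suc k) u) ++ ret ∷ substP P k (γ u)
    ≡⟨ γ-ƛ-++ (subst s (suc k) u) _ ⟨
  γ (subst (ƛ s) k u) ++ substP P k (γ u) ∎
  where open ≡-Reasoning

-- Simulation of one reduction step.

infix 4 _⇒_ _⇒β_

-- Reflexive because distinct partial terms may denote the same state.
_⇒_ : ∀ {s} → Partial s → Partial s → Set
c ⇒ d = ∀ P T V → ReflClosure _⟶_ (state c P T V) (state d P T V)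

-- Holding for all `P`, `T` and `V`, such a step lifts through `appL`, `appR` and `called`, which
-- merely instantiate these arguments of `state`.
_⇒β_ : ∀ {s t} → Partial s → Partial t → Set
c ⇒β d = ∀ P T V → state c P T V ⟶ state d P T V

split-· : ∀ s t → todo (s · t) ⇒ appL (todo s) t
split-· s t = λ P T V → reflexive (cong (λ R → R ∷tc T , V) (γ-·-++ s t P))

appL-⇒* : ∀ {s t} {c d : Partial s} → Star _⇒_ c d → Star _⇒_ (appL c t) (appL d t)
appL-⇒* {t = t} = gmap (λ c → appL c t) λ h P → h (γ t ++ app ∷ P)

appR-⇒* : ∀ {u t} {c d : Partial t} → Star _⇒_ c d → Star _⇒_ (appR u c) (appR u d)
appR-⇒* {u} = gmap (appR u) λ h P T V → h (app ∷ P) T (γ u ∷ V)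

called-⇒* : ∀ {s} {c d : Partial s} → Star _⇒_ c d → Star _⇒_ (called c) (called d)
called-⇒* = gmap called λ h P T → h [] (P ∷tc T)

to-val : ∀ {u} (c : Partial (ƛ u)) → Star _⇒_ c (val u)
to-val (todo (ƛ u)) = (λ P T V → one-step (pushVal (φ-body u P))) ◅ ε
to-val (val u)      = ε
-- Once the called code is a value, its task is empty and already dropped by `∷tc`, so returning
-- takes no machine step.
to-val (called c)   = called-⇒* (to-val c) ◅◅ (λ P T V → refl) ◅ ε

to-appR : ∀ {u t} (c : Partial (ƛ u)) → Star _⇒_ (appL c t) (appR u (todo t))
to-appR c = appL-⇒* (to-val c) ◅◅ (λ P T V → refl) ◅ ε

-- The code `lam ∷ γ t ++ [ ret ]` inserted by the machine is `γ (ƛ t)` itself. The contractum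
-- becomes a task of its own, hence `called`.
β-⇒β : ∀ s t → appR s (val t) ⇒β called (todo (subst s 0 (ƛ t)))
β-⇒β s t P T V = transport (state (appR s (val t)) P T V ⟶_) (cong (_, V) eq) reduce
  where
  open ≡-Reasoning
  s′ = subst s 0 (ƛ t)
  eq : substP (γ s) 0 (γ (ƛ t)) ∷ (P ∷tc T) ≡ (γ s′ ++ []) ∷tc (P ∷tc T)
  eq = begin
    substP (γ s) 0 (γ (ƛ t)) ∷ (P ∷tc T)
      ≡⟨ cong (λ R → substP R 0 (γ (ƛ t)) ∷ (P ∷tc T)) (++-identityʳ (γ s)) ⟨
    substP (γ s ++ []) 0 (γ (ƛ t)) ∷ (P ∷tc T)
      ≡⟨ cong (_∷ (P ∷tc T)) (substP-γ s 0 (ƛ t) []) ⟩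
    (γ s′ ++ []) ∷ (P ∷tc T)
      ≡⟨ ∷tc-γ s′ [] _ ⟨
    (γ s′ ++ []) ∷tc (P ∷tc T) ∎

Simulation : ∀ {s} → Partial s → Term → Set
Simulation {s} c s′ =
  Σ[ d ∈ Partial s ] Σ[ c′ ∈ Partial s′ ] (Star _⇒_ c d × d ⇒β c′)

infixr 4 _⇒*-then_

_⇒*-then_ : ∀ {s s′} {c d : Partial s} → Star _⇒_ c d → Simulation d s′ → Simulation c s′
p ⇒*-then (d , c′ , q , h) = d , c′ , p ◅◅ q , h

in-appL : ∀ {s t s′} {c : Partial s} → Simulation c s′ → Simulation (appL c t) (s′ · t)
in-appL {t = t} (d , c′ , p , h) =
  appL d t , appL c′ t , appL-⇒* p , λ P → h (γ t ++ app ∷ P)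

in-appR : ∀ {u t t′} {c : Partial t} → Simulation c t′ → Simulation (appR u c) ((ƛ u) · t′)
in-appR {u} (d , c′ , p , h) =
  appR u d , appR u c′ , appR-⇒* p , λ P T V → h (app ∷ P) T (γ u ∷ V)

in-called : ∀ {s s′} {c : Partial s} → Simulation c s′ → Simulation (called c) s′
in-called (d , c′ , p , h) =
  called d , called c′ , called-⇒* p , λ P T → h [] (P ∷tc T)

simulate-β : ∀ {s t} (c : Partial (ƛ t)) → Simulation (appR s c) (subst s 0 (ƛ t))
simulate-β {s} {t} c =
  appR s (val t) , called (todo (subst s 0 (ƛ t))) , appR-⇒* (to-val c) , β-⇒β s t

-- Evaluation is brought to the place where `r` acts. The missing cases would need an abstraction or
-- a variable to reduce.
simulate : ∀ {s s′} → s ≻ s′ → (c : Partial s) → Simulation c s′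
simulate r        (called c)     = in-called (simulate r c)
simulate β        (todo (s · t)) =
  split-· s t ◅ to-appR (todo s) ⇒*-then simulate-β (todo t)
simulate β        (appL c t)     = to-appR c ⇒*-then simulate-β (todo t)
simulate β        (appR u c)     = simulate-β c
simulate (appˡ r) (todo (s · t)) = split-· s t ◅ ε ⇒*-then in-appL (simulate r (todo s))
simulate (appˡ r) (appL c t)     = in-appL (simulate r c)
simulate (appʳ r) (todo (s · t)) =
  split-· s t ◅ to-appR (todo s) ⇒*-then in-appR (simulate r (todo t))
simulate (appʳ r) (appL c t)     = to-appR c ⇒*-then in-appR (simulate r (todo t))
simulate (appʳ r) (appR u c)     = in-appR (simulate r c)

-- Sizes of compiled code and of states.

weight : Prog → ℕ
weight P = sum (map sizeC P)

weight-++ : ∀ P Q → weight (P ++ Q) ≡ weight P + weight Q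
weight-++ P Q = trans (cong sum (map-++ sizeC P Q)) (sum-++ (map sizeC P) _)

weight-γ-· : ∀ s t → weight (γ (s · t)) ≡ 1 + (weight (γ s) + weight (γ t))
weight-γ-· s t = begin
  weight (γ s ++ γ t ++ [ app ])        ≡⟨ weight-++ (γ s) _ ⟩
  weight (γ s) + weight (γ t ++ [ app ]) ≡⟨ cong (weight (γ s) +_) (weight-++ (γ t) _) ⟩
  weight (γ s) + (weight (γ t) + 1)     ≡⟨ arith (weight (γ s)) (weight (γ t)) ⟩
  1 + (weight (γ s) + weight (γ t))     ∎
  where
  open ≡-Reasoning
  arith : ∀ a b → a + (b + 1) ≡ 1 + (a + b)
  arith = solve-∀

weight-γ-ƛ : ∀ s → weight (γ (ƛ s)) ≡ 2 + weight (γ s)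
weight-γ-ƛ s = cong suc (trans (weight-++ (γ s) [ ret ]) (+-comm _ 1))

-- The excess of `weight (γ s)` over `size s` is the number of abstractions in `s`, one `ret` for
-- each.
size≤weight-γ : ∀ s → size s ≤ weight (γ s)
size≤weight-γ (var n) = m≤m+n _ 0
size≤weight-γ (s · t) = ≤-trans
  (s≤s (+-mono-≤ (size≤weight-γ s) (size≤weight-γ t)))
  (≤-reflexive (sym (weight-γ-· s t)))
size≤weight-γ (ƛ s)   = ≤-trans
  (s≤s (m≤n⇒m≤1+n (size≤weight-γ s)))
  (≤-reflexive (sym (weight-γ-ƛ s)))

sizeP-γ≤2*size : ∀ s → sizeP (γ s) ≤ 2 * size s
sizeP-γ≤2*size (var n) = ≤-trans (m≤m+n _ n) (≤-reflexive (arith n))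
  where
  arith : ∀ n → 2 + (n + 0) + n ≡ 2 * (1 + n)
  arith = solve-∀
sizeP-γ≤2*size (s · t) = begin
  1 + weight (γ (s · t))                ≡⟨ cong suc (weight-γ-· s t) ⟩
  -- The units of the program and of `app` become the program units of the two parts, so both
  -- induction hypotheses apply.
  2 + (weight (γ s) + weight (γ t))     ≡⟨ arith₁ (weight (γ s)) (weight (γ t)) ⟩
  sizeP (γ s) + sizeP (γ t)             ≤⟨ +-mono-≤ (sizeP-γ≤2*size s) (sizeP-γ≤2*size t) ⟩
  2 * size s + 2 * size t               ≤⟨ m≤n+m _ 2 ⟩
  2 + (2 * size s + 2 * size t)         ≡⟨ arith₂ (size s) (size t) ⟩
  2 * (1 + size s + size t)             ∎
  where
  open ≤-Reasoning
  arith₁ : ∀ a b → 2 + (a + b) ≡ (1 + a) + (1 + b)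
  arith₁ = solve-∀
  arith₂ : ∀ a b → 2 + (2 * a + 2 * b) ≡ 2 * (1 + a + b)
  arith₂ = solve-∀
sizeP-γ≤2*size (ƛ s)   = begin
  1 + weight (γ (ƛ s))   ≡⟨ cong suc (weight-γ-ƛ s) ⟩
  2 + sizeP (γ s)        ≤⟨ +-monoʳ-≤ 2 (sizeP-γ≤2*size s) ⟩
  2 + 2 * size s         ≡⟨ *-suc 2 (size s) ⟨
  2 * (1 + size s)       ∎
  where open ≤-Reasoning

sizeL : List Prog → ℕ
sizeL T = sum (map sizeP T)

sizeL-∷tc-≤ : ∀ P T → sizeL (P ∷tc T) ≤ sizeP P + sizeL T
sizeL-∷tc-≤ []      T = n≤1+n _
sizeL-∷tc-≤ (_ ∷ _) T = ≤-refl

sizeL-∷tc-≥ : ∀ P T → weight P + sizeL T ≤ sizeL (P ∷tc T)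
sizeL-∷tc-≥ []      T = ≤-refl
sizeL-∷tc-≥ (_ ∷ _) T = n≤1+n _

sizeL-γ-∷tc : ∀ s P T → sizeL ((γ s ++ P) ∷tc T) ≡ sizeP (γ s) + (weight P + sizeL T)
sizeL-γ-∷tc s P T = begin
  sizeL ((γ s ++ P) ∷tc T)             ≡⟨ cong sizeL (∷tc-γ s P T) ⟩
  1 + weight (γ s ++ P) + sizeL T      ≡⟨ cong (λ n → 1 + n + sizeL T) (weight-++ (γ s) P) ⟩
  1 + (weight (γ s) + weight P) + sizeL T ≡⟨ cong suc (+-assoc (weight (γ s)) _ _) ⟩
  sizeP (γ s) + (weight P + sizeL T)   ∎
  where open ≡-Reasoning

-- The remaining work `P ∷tc T , V` is counted on both sides, so waiting code passes through the
-- induction hypothesis. The unit of the task containing `P` covers the unit that `P` has when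
-- pushed alone.
state-size-≥ : ∀ {s} (c : Partial s) P T V →
               size s + sizeS (P ∷tc T , V) ≤ sizeS (state c P T V)
state-size-≥ (todo s) P T V = begin
  size s + (sizeL (P ∷tc T) + sizeL V)
    ≤⟨ +-mono-≤ (size≤weight-γ s) (+-monoˡ-≤ (sizeL V) (sizeL-∷tc-≤ P T)) ⟩
  weight (γ s) + (1 + weight P + sizeL T + sizeL V)
    ≡⟨ arith (weight (γ s)) (weight P) (sizeL T) (sizeL V) ⟩
  sizeP (γ s) + (weight P + sizeL T) + sizeL V
    ≡⟨ cong (_+ sizeL V) (sizeL-γ-∷tc s P T) ⟨
  sizeL ((γ s ++ P) ∷tc T) + sizeL V ∎
  where
  open ≤-Reasoning
  arith : ∀ a p t v → a + (1 + p + t + v) ≡ 1 + a + (p + t) + v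
  arith = solve-∀
state-size-≥ (val u) P T V = begin
  1 + size u + (sizeL (P ∷tc T) + sizeL V)
    ≡⟨ arith (size u) (sizeL (P ∷tc T)) (sizeL V) ⟩
  sizeL (P ∷tc T) + (1 + size u + sizeL V)
    ≤⟨ +-monoʳ-≤ (sizeL (P ∷tc T)) (+-monoˡ-≤ (sizeL V) (s≤s (size≤weight-γ u))) ⟩
  sizeL (P ∷tc T) + (sizeP (γ u) + sizeL V) ∎
  where
  open ≤-Reasoning
  arith : ∀ a p v → 1 + a + (p + v) ≡ p + (1 + a + v)
  arith = solve-∀
state-size-≥ (appL {s} c t) P T V = begin
  1 + size s + size t + (sizeL (P ∷tc T) + sizeL V)
    ≤⟨ +-mono-≤ (+-monoʳ-≤ (1 + size s) (size≤weight-γ t)) (+-monoˡ-≤ (sizeL V) (sizeL-∷tc-≤ P T)) ⟩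
  1 + size s + weight (γ t) + (1 + weight P + sizeL T + sizeL V)
    ≡⟨ arith (size s) (weight (γ t)) (weight P) (sizeL T) (sizeL V) ⟩
  size s + (sizeP (γ t) + (1 + weight P + sizeL T) + sizeL V)
    ≡⟨ cong (λ n → size s + (n + sizeL V)) (sizeL-γ-∷tc t (app ∷ P) T) ⟨
  size s + (sizeL ((γ t ++ app ∷ P) ∷tc T) + sizeL V)
    ≤⟨ state-size-≥ c _ T V ⟩
  sizeS (state c (γ t ++ app ∷ P) T V) ∎
  where
  open ≤-Reasoning
  arith : ∀ a b p t v → 1 + a + b + (1 + p + t + v) ≡ a + (1 + b + (1 + p + t) + v)
  arith = solve-∀
state-size-≥ (appR u {t} c) P T V = begin
  1 + (1 + size u) + size t + (sizeL (P ∷tc T) + sizeL V)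
    ≤⟨ +-mono-≤ (+-monoˡ-≤ (size t) (+-monoʳ-≤ 2 (size≤weight-γ u))) (+-monoˡ-≤ (sizeL V) (sizeL-∷tc-≤ P T)) ⟩
  1 + (1 + weight (γ u)) + size t + (1 + weight P + sizeL T + sizeL V)
    ≡⟨ arith (size t) (weight (γ u)) (weight P) (sizeL T) (sizeL V) ⟩
  size t + (2 + weight P + sizeL T + (sizeP (γ u) + sizeL V))
    ≤⟨ state-size-≥ c _ T _ ⟩
  sizeS (state c (app ∷ P) T (γ u ∷ V)) ∎
  where
  open ≤-Reasoning
  arith : ∀ a b p t v → 1 + (1 + b) + a + (1 + p + t + v) ≡ a + (2 + p + t + (1 + b + v))
  arith = solve-∀
state-size-≥ (called c) P T V = state-size-≥ c [] (P ∷tc T) V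

state-size-≤ : ∀ {s} (c : Partial s) P T V →
               sizeS (state c P T V) ≤ 2 * size s + sizeS (P ∷tc T , V)
state-size-≤ (todo s) P T V = begin
  sizeL ((γ s ++ P) ∷tc T) + sizeL V
    ≡⟨ cong (_+ sizeL V) (sizeL-γ-∷tc s P T) ⟩
  sizeP (γ s) + (weight P + sizeL T) + sizeL V
    ≤⟨ +-monoˡ-≤ (sizeL V) (+-mono-≤ (sizeP-γ≤2*size s) (sizeL-∷tc-≥ P T)) ⟩
  2 * size s + sizeL (P ∷tc T) + sizeL V
    ≡⟨ +-assoc (2 * size s) _ _ ⟩
  2 * size s + (sizeL (P ∷tc T) + sizeL V) ∎
  where open ≤-Reasoning
state-size-≤ (val u) P T V = begin
  sizeL (P ∷tc T) + (sizeP (γ u) + sizeL V)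
    ≤⟨ +-monoʳ-≤ (sizeL (P ∷tc T)) (+-monoˡ-≤ (sizeL V) (sizeP-γ≤2*size u)) ⟩
  sizeL (P ∷tc T) + (2 * size u + sizeL V)
    ≤⟨ m≤n+m _ 2 ⟩
  2 + (sizeL (P ∷tc T) + (2 * size u + sizeL V))
    ≡⟨ arith (size u) (sizeL (P ∷tc T)) (sizeL V) ⟩
  2 * (1 + size u) + (sizeL (P ∷tc T) + sizeL V) ∎
  where
  open ≤-Reasoning
  arith : ∀ a p v → 2 + (p + (2 * a + v)) ≡ 2 * (1 + a) + (p + v)
  arith = solve-∀
state-size-≤ (appL {s} c t) P T V = begin
  sizeS (state c (γ t ++ app ∷ P) T V)
    ≤⟨ state-size-≤ c _ T V ⟩
  2 * size s + (sizeL ((γ t ++ app ∷ P) ∷tc T) + sizeL V)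
    ≡⟨ cong (λ n → 2 * size s + (n + sizeL V)) (sizeL-γ-∷tc t (app ∷ P) T) ⟩
  2 * size s + (sizeP (γ t) + (1 + (weight P + sizeL T)) + sizeL V)
    ≤⟨ +-monoʳ-≤ (2 * size s) (+-monoˡ-≤ (sizeL V)
         (+-mono-≤ (sizeP-γ≤2*size t) (s≤s (sizeL-∷tc-≥ P T)))) ⟩
  2 * size s + (2 * size t + (1 + sizeL (P ∷tc T)) + sizeL V)
    ≤⟨ n≤1+n _ ⟩
  1 + (2 * size s + (2 * size t + (1 + sizeL (P ∷tc T)) + sizeL V))
    ≡⟨ arith (size s) (size t) (sizeL (P ∷tc T)) (sizeL V) ⟩
  2 * (1 + size s + size t) + (sizeL (P ∷tc T) + sizeL V) ∎
  where
  open ≤-Reasoning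
  arith : ∀ a b p v → 1 + (2 * a + (2 * b + (1 + p) + v)) ≡ 2 * (1 + a + b) + (p + v)
  arith = solve-∀
state-size-≤ (appR u {t} c) P T V = begin
  sizeS (state c (app ∷ P) T (γ u ∷ V))
    ≤⟨ state-size-≤ c _ T _ ⟩
  -- The 2 is the unit of the waiting task plus its `app`; the doubled application node pays for
  -- both.
  2 * size t + (2 + (weight P + sizeL T) + (sizeP (γ u) + sizeL V))
    ≤⟨ +-monoʳ-≤ (2 * size t) (+-mono-≤ (+-monoʳ-≤ 2 (sizeL-∷tc-≥ P T))
         (+-monoˡ-≤ (sizeL V) (sizeP-γ≤2*size u))) ⟩
  2 * size t + (2 + sizeL (P ∷tc T) + (2 * size u + sizeL V))
    ≤⟨ m≤n+m _ 2 ⟩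
  2 + (2 * size t + (2 + sizeL (P ∷tc T) + (2 * size u + sizeL V)))
    ≡⟨ arith (size t) (size u) (sizeL (P ∷tc T)) (sizeL V) ⟩
  2 * (1 + (1 + size u) + size t) + (sizeL (P ∷tc T) + sizeL V) ∎
  where
  open ≤-Reasoning
  arith : ∀ a b p v → 2 + (2 * a + (2 + p + (2 * b + v))) ≡ 2 * (1 + (1 + b) + a) + (p + v)
  arith = solve-∀
state-size-≤ (called c) P T V = state-size-≤ c [] (P ∷tc T) V

-- Whole reduction sequences.

initial : ∀ {s} → Partial s → State
initial c = state c [] [] []

size≤initial : ∀ {s} (c : Partial s) → size s ≤ sizeS (initial c)
size≤initial {s} c = ≤-trans (m≤m+n (size s) 0) (state-size-≥ c [] [] [])

initial≤2*size : ∀ {s} (c : Partial s) → sizeS (initial c) ≤ 2 * size s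
initial≤2*size {s} c = ≤-trans (state-size-≤ c [] [] []) (≤-reflexive (+-identityʳ (2 * size s)))

head≤peak : ∀ {x y} (ρ : Star _⟶_ x y) → sizeS x ≤ peak sizeS ρ
head≤peak ε       = ≤-refl
head≤peak (_ ◅ ρ) = m≤m⊔n _ (peak sizeS ρ)

-- All states of the chain denote the same `s`, so `2 * size s` bounds each of them, and prepending
-- states never lowers the peak.
prepend-⇒* : ∀ {s y B} {c d : Partial s} → 2 * size s ≤ B → Star _⇒_ c d →
             (ρ : Star _⟶_ (initial d) y) → peak sizeS ρ ≤ B →
             Σ[ ρ′ ∈ Star _⟶_ (initial c) y ]
               (peak sizeS ρ ≤ peak sizeS ρ′ × peak sizeS ρ′ ≤ B)
prepend-⇒* 2s≤B ε ρ ρ≤B = ρ , ≤-refl , ρ≤B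
prepend-⇒* {s} {y} {B} {c} 2s≤B (h ◅ p) ρ ρ≤B with prepend-⇒* 2s≤B p ρ ρ≤B
... | ρ′ , ρ≤ρ′ , ρ′≤B = extend (h [] [] []) ρ′ ρ≤ρ′ ρ′≤B
  where
  extend : ∀ {x} → ReflClosure _⟶_ (initial c) x → (ρ′ : Star _⟶_ x y) →
           peak sizeS ρ ≤ peak sizeS ρ′ → peak sizeS ρ′ ≤ B →
           Σ[ ρ″ ∈ Star _⟶_ (initial c) y ]
             (peak sizeS ρ ≤ peak sizeS ρ″ × peak sizeS ρ″ ≤ B)
  extend refl         ρ′ lower upper = ρ′ , lower , upper
  extend (one-step x) ρ′ lower upper =
    x ◅ ρ′ , ≤-trans lower (m≤n⊔m _ (peak sizeS ρ′)) ,
    ⊔-lub (≤-trans (initial≤2*size c) 2s≤B) upper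

simulate-star : ∀ {s u} (r : Star _≻_ s (ƛ u)) (c : Partial s) →
                Σ[ ρ ∈ Star _⟶_ (initial c) ([] , [ γ u ]) ]
                  (peak size r ≤ peak sizeS ρ × peak sizeS ρ ≤ 2 * peak size r)
-- `initial (val u)` computes to the final state, so the run after `to-val c` is empty.
simulate-star {u = u} ε c with prepend-⇒* ≤-refl (to-val c) ε (initial≤2*size (val u))
... | ρ , _ , upper = ρ , ≤-trans (size≤initial c) (head≤peak ρ) , upper
simulate-star {s} (x ◅ r) c with simulate x c
... | d , c′ , p , h with simulate-star r c′
... | ρ , lower , upper
  with prepend-⇒* (*-monoʳ-≤ 2 (m≤m⊔n (size s) (peak size r))) p (h [] [] [] ◅ ρ)
         (⊔-lub (≤-trans (initial≤2*size d) (*-monoʳ-≤ 2 (m≤m⊔n (size s) (peak size r))))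
                (≤-trans upper (*-monoʳ-≤ 2 (m≤n⊔m (size s) (peak size r)))))
... | ρ′ , lower′ , upper′ =
  ρ′ ,
  -- The first state accounts for `size s`; the run `ρ` accounts for all later terms.
  ⊔-lub (≤-trans (size≤initial c) (head≤peak ρ′))
        (≤-trans lower (≤-trans (m≤n⊔m _ (peak sizeS ρ)) lower′)) ,
  upper′

initial-todo : ∀ s → initial (todo s) ≡ τ s
initial-todo s = cong (_, []) (trans (∷tc-γ s [] []) (cong [_] (++-identityʳ (γ s))))

theorem15 : ∀ (s t : Term) → Abstraction t →
    ∀ (r : Star _≻_ s t) (m : ℕ) → m ≡ peak size r →
    Σ[ P ∈ Prog ] Σ[ m′ ∈ ℕ ]
    (P ≫ t × m ≤ m′ × m′ ≤ 2 * m ×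
    (Σ[ r′ ∈ Star _⟶_ (τ s) ([] , [ P ]) ] peak sizeS r′ ≡ m′))
theorem15 s _ (u , refl) r _ refl
  with ρ , lower , upper ← transport
         (λ x → Σ[ ρ ∈ Star _⟶_ x ([] , [ γ u ]) ]
                  (peak size r ≤ peak sizeS ρ × peak sizeS ρ ≤ 2 * peak size r))
         (initial-todo s) (simulate-star r (todo s))
  = γ u , peak sizeS ρ , (u , refl , refl) , lower , upper , ρ , refl
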